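{- If a subset $A\subseteq\omega^\omega$ is $\Delta^0_2$ over $\omega^\omega$, then $A$ is recursive over $\omega^\omega$.
   Context: Write $\mathbb{N}=\omega=\{0,1,2,\dots\}$, $\mathcal{N}=\omega^\omega$ (Baire space), and $0_{\mathcal{N}}$ for the constant zero sequence. All functions may be partial. Universal TTE-computable functions. Fix standard effective enumerations of oracle Turing machines with $q$ oracles from $\mathcal{N}$ ($q\ge 0$). $\Phi^{\vec x}(e,i)$ is the result of the $e$-th machine on input $i$ with oracles $\vec x=(x_1,\dots,x_q)$, and $\Psi_q(e;\vec x)=\Phi^{\vec x}(e)$ is the sequence $y\in\mathcal{N}$ with $y(i)=\Phi^{\vec x}(e,i)$; it is defined iff $\Phi^{\vec x}(e,i)$ is defined for all $i$. Partial recursive functions over $\mathcal{N}$. This is the smallest class of partial functions from $\mathbb{N}^p\times\mathcal{N}^q$ ($p+q\ge1$) to $\mathbb{N}$ or $\mathcal{N}$ that contains: the zero function $\mathbb{N}\to\mathbb{N}$, the successor function $\mathbb{N}\to\mathbb{N}$, all projections $(n_1,\dots,n_p;x_1,\dots,x_q)\mapsto n_i$ or $x_j$, the universal functions $\Psi_q$, and $\chi:\mathcal{N}\to\mathbb{N}$ with $\chi(0_{\mathcal{N}})=1$ and $\chi(x)=0$ for $x\ne0_{\mathcal{N}}$; and that is closed under: composition $f(g_1(\vec m;\vec y),\dots,g_p(\vec m;\vec y);h_1(\vec m;\vec y),\dots,h_q(\vec m;\vec y))$ (with $g_i$ having codomain $\mathbb{N}$ and $h_j$ codomain $\mathcal{N}$;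 the value is defined only if all inner values are); primitive recursion on a numerical variable, $F(0,\vec n;\vec x)=G(\vec n;\vec x)$, $F(k+1,\vec n;\vec x)=H(k,\vec n;\vec x,F(k,\vec n;\vec x))$ for codomain $\mathcal{N}$, and analogously $F(k+1,\vec n;\vec x)=H(k,\vec n,F(k,\vec n;\vec x);\vec x)$ for codomain $\mathbb{N}$; and the $\mu$-operator on $\mathbb{N}$: from $G:\mathbb{N}^{p+1}\times\mathcal{N}^q\to\mathbb{N}$ one obtains $F(\vec n;\vec x)=$ the least $k$ such that $G(k,\vec n;\vec x)=0$ and $G(k',\vec n;\vec x)$ is defined and nonzero for all $k'<k$ (undefined if there is no such $k$). A subset $A\subseteq\mathcal{N}$ is recursive over $\mathcal{N}$ if its (total) characteristic function $\chi_A:\mathcal{N}\to\mathbb{N}$ is partial recursive over $\mathcal{N}$. For $\sigma\in\omega^{<\omega}$ let $[\![\sigma]\!]=\{f\in\mathcal{N}:\sigma\prec f\}$. A set $A\subseteq\mathcal{N}$ is $\Pi^0_2$ (effectively $G_\delta$) if there is a recursive double sequence $\langle\sigma_{i,j}\rangle$ in $\omega^{<\omega}$ with $A=\bigcap_i\bigcup_j[\![\sigma_{i,j}]\!]$; it is $\Sigma^0_2$ (effectively $F_\sigma$) if its complement is $\Pi^0_2$; it is $\Delta^0_2$ over $\mathcal{N}$ if it is both. -}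

module Defs where

open import Data.Bool using (if_then_else_; _∧_)
open import Data.Fin using (Fin; toℕ; fromℕ<)
open import Data.Fin.Properties using (toℕ<n; fromℕ<-toℕ)
open import Data.List using (List; []; _∷_; length; replicate)
import Data.List as List
open import Data.Maybe using (Maybe; just; nothing; _<∣>_)
open import Data.Nat using (ℕ; zero; suc; _+_; _≤_; _<_; s≤s; _≟_; _<?_; NonZero)
open import Data.Nat.Properties
  using (+-suc; +-identityʳ; suc-injective; ≤-refl; ≤-trans; m≤m+n)
open import Data.Product using (_×_; _,_; ∃; ∃₂; uncurry)
open import Data.Product.Function.NonDependent.Propositional using (_×-↠_)
open import Data.Sum using (_⊎_)
open import Data.Vec using (Vec; []; _∷_; _∷ʳ_; lookup)
import Data.Vec as Vec
import Data.Vec.Properties as Vec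
open import Function using (StrictlySurjective; _⇔_; _↠_; mk↠ₛ; Surjection)
open import Function.Construct.Composition using () renaming (surjection to _then_)
open import Level using (0ℓ)
open import Relation.Binary.PropositionalEquality
  using (_≡_; _≢_; _≗_; refl; cong; cong₂)
open import Relation.Nullary using (¬_; yes; no; does; contradiction)
open import Relation.Unary using (Pred; ∁)

------------------------------------------------------------------------
-- Baire space

-- Function extensionality is not available, so equality of points of 𝒩
-- is pointwise equality _≗_ throughout.
𝒩 : Set
𝒩 = ℕ → ℕ

0𝒩 : 𝒩
0𝒩 _ = 0

------------------------------------------------------------------------
-- Codings of pairs and of finite sequences by natural numbers

triangle : ℕ → ℕ
triangle zero    = 0
triangle (suc n) = suc n + triangle n

-- Cantor's pairing function (a bijection ℕ × ℕ → ℕ).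
pair : ℕ → ℕ → ℕ
pair a b = b + triangle (a + b)

nextPair : ℕ × ℕ → ℕ × ℕ
nextPair (zero  , b) = suc b , 0
nextPair (suc a , b) = a , suc b

unpair : ℕ → ℕ × ℕ
unpair zero    = 0 , 0
unpair (suc n) = nextPair (unpair n)

unpair-pair : ∀ a b → unpair (pair a b) ≡ (a , b)
unpair-pair a b = go (a + b) a b refl
  where
  go : ∀ d a b → a + b ≡ d → unpair (pair a b) ≡ (a , b)
  go d a (suc b) eq rewrite +-suc a b | go d (suc a) b eq = refl
  go d zero zero eq = refl
  go (suc d) (suc a) zero eq
    rewrite +-identityʳ a | go d zero a (suc-injective eq) = refl

codeList : List ℕ → ℕ
codeList []      = 0
codeList (a ∷ s) = suc (pair a (codeList s))

decodeWithin : ℕ → ℕ → List ℕ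
decodeWithin _          zero    = []
decodeWithin zero       (suc n) = []
decodeWithin (suc fuel) (suc n) =
  let a , m = unpair n in a ∷ decodeWithin fuel m

decodeList : ℕ → List ℕ
decodeList n = decodeWithin n n

decodeList-codeList : ∀ s → decodeList (codeList s) ≡ s
decodeList-codeList s = go (codeList s) s ≤-refl
  where
  go : ∀ fuel s → codeList s ≤ fuel → decodeWithin fuel (codeList s) ≡ s
  go zero       []      _       = refl
  go (suc fuel) []      _       = refl
  go (suc fuel) (a ∷ s) (s≤s p)
    rewrite unpair-pair a (codeList s) =
      cong (a ∷_) (go fuel s (≤-trans (m≤m+n (codeList s) _) p))

------------------------------------------------------------------------
-- Oracle Turing machines

-- The tape alphabet is drawn from ℕ, with 0 the blank and 1 the stroke
-- of the unary notation; states are drawn from ℕ, with 0 initial.  A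
-- program is a finite list of instructions, so a machine has only
-- finitely many relevant symbols and states.

data Direction : Set where
  left right stay : Direction

-- Instructions for k tapes and q oracles.
data Instruction (q k : ℕ) : Set where
  -- in state s, scanning the given symbols: on each tape write a symbol
  -- and move the head; then enter state s′
  move  : (s : ℕ) (scanned : Vec ℕ k) (actions : Vec (ℕ × Direction) k)
          (s′ : ℕ) → Instruction q k
  -- in state s: replace the number n on the query tape by the value at
  -- n of the j-th oracle; then enter state s′
  query : (s : ℕ) (j : Fin q) (s′ : ℕ) → Instruction q k

-- Tape 0 is the input and output tape, tape 1 the query tape; there are
-- `extra` further work tapes.
record Machine (q : ℕ) : Set where
  constructor mkMachine
  field
    extra   : ℕ
    program : List (Instruction q (2 + extra))

-- A two-way infinite tape, blank outside the stored part; the cells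
-- before the head are listed from the head outwards.
record Tape : Set where
  constructor tape
  field
    before : List ℕ
    head   : ℕ
    after  : List ℕ

fromCells : List ℕ → List ℕ → Tape
fromCells ls []       = tape ls 0 []
fromCells ls (a ∷ rs) = tape ls a rs

act : ℕ × Direction → Tape → Tape
act (a , stay)  (tape ls       _ rs) = tape ls a rs
act (a , right) (tape ls       _ rs) = fromCells (a ∷ ls) rs
act (a , left)  (tape []       _ rs) = tape [] 0 (a ∷ rs)
act (a , left)  (tape (b ∷ ls) _ rs) = tape ls b (a ∷ rs)

numeral : ℕ → Tape
numeral n = fromCells [] (replicate n 1)

strokes : List ℕ → ℕ
strokes (1 ∷ as) = suc (strokes as)
strokes _        = 0

-- The number of consecutive strokes from the head rightwards.
value : Tape → ℕ
value (tape _ a rs) = strokes (a ∷ rs)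

record Config (k : ℕ) : Set where
  constructor config
  field
    state : ℕ
    tapes : Vec Tape k

module _ {q : ℕ} (xs : Vec 𝒩 q) where

  apply : ∀ {w} → Instruction q (2 + w) → Config (2 + w) →
          Maybe (Config (2 + w))
  apply (move s scanned actions s′) (config t ts) =
    if does (s ≟ t) ∧ does (Vec.≡-dec _≟_ scanned (Vec.map Tape.head ts))
    then just (config s′ (Vec.zipWith act actions ts))
    else nothing
  apply (query s j s′) (config t (io ∷ qt ∷ ts)) =
    if does (s ≟ t)
    then just (config s′ (io ∷ numeral (lookup xs j (value qt)) ∷ ts))
    else nothing

  -- The first applicable instruction is executed; the machine halts
  -- when there is none.
  step : ∀ {w} → List (Instruction q (2 + w)) → Config (2 + w) →
         Maybe (Config (2 + w))
  step []      c = nothing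
  step (I ∷ P) c = apply I c <∣> step P c

  data Halts {w} (P : List (Instruction q (2 + w))) :
             Config (2 + w) → ℕ → Set where
    halted : ∀ {c} → step P c ≡ nothing →
             Halts P c (value (Vec.head (Config.tapes c)))
    next   : ∀ {c c′ n} → step P c ≡ just c′ → Halts P c′ n → Halts P c n

initial : ∀ {w} → ℕ → Config (2 + w)
initial i = config 0 (numeral i ∷ Vec.replicate _ (numeral 0))

-- Enumeration of the machines.

pairs : {A B : Set} → ℕ ↠ A → ℕ ↠ B → ℕ ↠ (A × B)
pairs f g =
  mk↠ₛ {to = unpair} (λ (a , b) → pair a b , unpair-pair a b) then (f ×-↠ g)

numbers : ℕ ↠ ℕ
numbers = mk↠ₛ {to = λ n → n} (λ n → n , refl)

directions : ℕ ↠ Direction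
directions = mk↠ₛ {to = to} surj
  where
  to : ℕ → Direction
  to 0 = left
  to 1 = right
  to _ = stay
  surj : StrictlySurjective _≡_ to
  surj left  = 0 , refl
  surj right = 1 , refl
  surj stay  = 2 , refl

vectors : {A : Set} → ℕ ↠ A → ∀ k → ℕ ↠ Vec A k
vectors f zero    = mk↠ₛ {to = λ _ → []} (λ { [] → 0 , refl })
vectors f (suc k) = pairs f (vectors f k) then
  mk↠ₛ {to = uncurry _∷_} (λ { (a ∷ as) → (a , as) , refl })

lists : {A : Set} → ℕ ↠ A → ℕ ↠ List A
lists {A} f =
  mk↠ₛ {to = decodeList} (λ s → codeList s , decodeList-codeList s) then
  mk↠ₛ {to = List.map to} surj
  where
  open Surjection f using (to; strictlySurjective)
  surj : StrictlySurjective _≡_ (List.map to)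
  surj []       = [] , refl
  surj (a ∷ as) =
    let n  , p  = strictlySurjective a
        ns , ps = surj as
    in n ∷ ns , cong₂ _∷_ p ps

-- The first component is 0 for a move and suc j for a query of the
-- j-th oracle (read as a move if there is no such oracle).
instructions : ∀ q k → ℕ ↠ Instruction q k
instructions q k =
  pairs numbers (pairs numbers (pairs (vectors numbers k)
    (pairs (vectors (pairs numbers directions) k) numbers)))
  then mk↠ₛ {to = to} surj
  where
  to : ℕ × ℕ × Vec ℕ k × Vec (ℕ × Direction) k × ℕ → Instruction q k
  to (zero  , s , scanned , actions , s′) = move s scanned actions s′
  to (suc j , s , scanned , actions , s′) with j <? q
  ... | yes j<q = query s (fromℕ< j<q) s′
  ... | no  _   = move s scanned actions s′
  to-query : ∀ s j s′ {as bs} → to (suc (toℕ j) , s , as , bs , s′) ≡ query s j s′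
  to-query s j s′ with toℕ j <? q
  ... | yes j<q = cong (λ i → query s i s′) (fromℕ<-toℕ j j<q)
  ... | no  j≮q = contradiction (toℕ<n j) j≮q
  surj : StrictlySurjective _≡_ to
  surj (move s scanned actions s′) = (0 , s , scanned , actions , s′) , refl
  surj (query s j s′) =
    (suc (toℕ j) , s , Vec.replicate k 0 , Vec.replicate k (0 , stay) , s′) ,
    to-query s j s′

machine : ∀ q → ℕ → Machine q
machine q e =
  let w , n = unpair e
  in mkMachine w (Surjection.to (lists (instructions q (2 + w))) n)

machine-surjective : ∀ q → StrictlySurjective _≡_ (machine q)
machine-surjective q (mkMachine w P)
  with n , eq ← Surjection.strictlySurjective (lists (instructions q (2 + w))) P =
  pair w n , lemma
  where
  lemma : machine q (pair w n) ≡ mkMachine w P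
  lemma rewrite unpair-pair w n = cong (mkMachine w) eq

-- The graph of Φ: Φ xs e i n says that the e-th machine with oracles xs
-- halts on input i with output n.
Φ : ∀ {q} → Vec 𝒩 q → ℕ → ℕ → ℕ → Set
Φ {q} xs e i n = Halts xs (Machine.program (machine q e)) (initial i) n

------------------------------------------------------------------------
-- Partial recursive functions over 𝒩

data Codomain : Set where
  num seq : Codomain

Value : Codomain → Set
Value num = ℕ
Value seq = 𝒩

-- Partial functions ℕᵖ × 𝒩^q ⇀ ℕ or 𝒩, given by their graphs.
PFun : ℕ → ℕ → Codomain → Set₁
PFun p q τ = Vec ℕ p → Vec 𝒩 q → Value τ → Set

zeroᶠ : PFun 1 0 num
zeroᶠ _ _ v = v ≡ 0

sucᶠ : PFun 1 0 num
sucᶠ (n ∷ []) _ v = v ≡ suc n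

projℕ : ∀ {p q} → Fin p → PFun p q num
projℕ i ns xs v = v ≡ lookup ns i

proj𝒩 : ∀ {p q} → Fin q → PFun p q seq
proj𝒩 j ns xs y = y ≗ lookup xs j

Ψ : ∀ q → PFun 1 q seq
Ψ q (e ∷ []) xs y = ∀ i → Φ xs e i (y i)

χ : PFun 0 1 num
χ _ (x ∷ []) v = (x ≗ 0𝒩 × v ≡ 1) ⊎ (¬ (x ≗ 0𝒩) × v ≡ 0)

compose : ∀ {p q m n τ} → PFun p q τ →
          (Fin p → PFun m n num) → (Fin q → PFun m n seq) → PFun m n τ
compose f g h ms ys v = ∃₂ λ ns xs →
  (∀ i → g i ms ys (lookup ns i)) × (∀ j → h j ms ys (lookup xs j)) × f ns xs v

primrecℕ : ∀ {p q} → PFun p q num → PFun (2 + p) q num → PFun (1 + p) q num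
primrecℕ G H (zero  ∷ ns) xs v = G ns xs v
primrecℕ G H (suc k ∷ ns) xs v =
  ∃ λ u → primrecℕ G H (k ∷ ns) xs u × H (k ∷ (ns ∷ʳ u)) xs v

primrec𝒩 : ∀ {p q} → PFun p q seq → PFun (1 + p) (1 + q) seq → PFun (1 + p) q seq
primrec𝒩 G H (zero  ∷ ns) xs v = G ns xs v
primrec𝒩 G H (suc k ∷ ns) xs v =
  ∃ λ u → primrec𝒩 G H (k ∷ ns) xs u × H (k ∷ ns) (xs ∷ʳ u) v

minimize : ∀ {p q} → PFun (1 + p) q num → PFun p q num
minimize G ns xs k =
  G (k ∷ ns) xs 0 × (∀ k′ → k′ < k → ∃ λ v → G (k′ ∷ ns) xs v × v ≢ 0)

-- The side condition on μ-rec keeps p + q ≥ 1: no other constructor can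
-- produce a function without arguments from functions with arguments.
data PartialRecursive : ∀ {p q τ} → PFun p q τ → Set₁ where
  zero-rec  : PartialRecursive zeroᶠ
  suc-rec   : PartialRecursive sucᶠ
  projℕ-rec : ∀ {p q} i → PartialRecursive (projℕ {p} {q} i)
  proj𝒩-rec : ∀ {p q} j → PartialRecursive (proj𝒩 {p} {q} j)
  Ψ-rec     : ∀ q → PartialRecursive (Ψ q)
  χ-rec     : PartialRecursive χ
  comp-rec  : ∀ {p q m n τ} {f : PFun p q τ}
              {g : Fin p → PFun m n num} {h : Fin q → PFun m n seq} →
              PartialRecursive f →
              (∀ i → PartialRecursive (g i)) → (∀ j → PartialRecursive (h j)) →
              PartialRecursive (compose f g h)
  primℕ-rec : ∀ {p q} {G : PFun p q num} {H : PFun (2 + p) q num} →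
              PartialRecursive G → PartialRecursive H →
              PartialRecursive (primrecℕ G H)
  prim𝒩-rec : ∀ {p q} {G : PFun p q seq} {H : PFun (1 + p) (1 + q) seq} →
              PartialRecursive G → PartialRecursive H →
              PartialRecursive (primrec𝒩 G H)
  μ-rec     : ∀ {p q} .{{_ : NonZero (p + q)}} {G : PFun (1 + p) q num} →
              PartialRecursive G → PartialRecursive (minimize G)
  -- partial functions with the same graph are identified
  graph-rec : ∀ {p q τ} {F G : PFun p q τ} →
              (∀ ns xs v → F ns xs v ⇔ G ns xs v) →
              PartialRecursive F → PartialRecursive G

characteristic : Pred 𝒩 0ℓ → PFun 0 1 num
characteristic A _ (x ∷ []) v = (A x × v ≡ 1) ⊎ (¬ A x × v ≡ 0)

Recursive : Pred 𝒩 0ℓ → Set₁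
Recursive A = PartialRecursive (characteristic A)

------------------------------------------------------------------------
-- The arithmetical classes

⟦_⟧ : List ℕ → Pred 𝒩 0ℓ
⟦ σ ⟧ f = ∀ (k : Fin (length σ)) → f (toℕ k) ≡ List.lookup σ k

-- A double sequence of finite sequences is recursive when an oracle-free
-- machine computes the code of σ i j from the code of (i , j).
RecursiveDoubleSequence : (ℕ → ℕ → List ℕ) → Set
RecursiveDoubleSequence σ = ∃ λ e → ∀ i j → Φ [] e (pair i j) (codeList (σ i j))

Π⁰₂ : Pred 𝒩 0ℓ → Set
Π⁰₂ A = ∃ λ σ → RecursiveDoubleSequence σ ×
  (∀ f → A f ⇔ (∀ i → ∃ λ j → ⟦ σ i j ⟧ f))

Σ⁰₂ : Pred 𝒩 0ℓ → Set
Σ⁰₂ A = Π⁰₂ (∁ A)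

Δ⁰₂ : Pred 𝒩 0ℓ → Set
Δ⁰₂ A = Σ⁰₂ A × Π⁰₂ A

{-# OPTIONS --safe #-}

-- Let σ witness that A is Π⁰₂, and τ that its complement is.  Exactly one of
-- ∀ i ∃ j ⟦ σ i j ⟧ x and ∀ i ∃ j ⟦ τ i j ⟧ x holds, so a search for an i at which one of
-- them fails succeeds for every x, and the failing one tells whether x ∈ A.  Each single test
-- ∃ j ⟦ σ i j ⟧ x is decided by applying χ to a sequence computable from i and x that vanishes
-- exactly when there is no such j.
--
-- No machine has to be simulated to produce that sequence: n ↦ codeList (σ of the pair n) is
-- itself a point of 𝒩, given by Ψ 0, and so are the components of n, the zero sequence and the
-- indicator of {i}.  A single fixed machine, with these and x as oracles, then compares the
-- decoded list with x.
module Submission where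

open import Defs
open import Axiom.ExcludedMiddle using (ExcludedMiddle)
open import Level using (0ℓ)
open import Relation.Unary using (Pred)
open import Data.Bool using (if_then_else_)
open import Data.Fin using (Fin; zero; suc; toℕ)
open import Data.List using (List; []; _∷_; replicate)
import Data.List as List
open import Data.Maybe using (nothing)
open import Data.Maybe.Properties using (just-injective)
open import Data.Nat using (ℕ; zero; suc; _+_; _≟_; pred; _<_; s≤s)
open import Data.Nat.Properties using (+-suc; +-comm; +-identityʳ; suc-injective)
open import Data.Product using (_×_; _,_; proj₁; proj₂; ∃; uncurry)
open import Data.Sum using (_⊎_; inj₁; inj₂)
open import Data.Vec using (Vec; []; _∷_; head; lookup; tabulate)
open import Data.Vec.Properties using (lookup∘tabulate; tabulate∘lookup; tabulate-cong)
open import Function using (_∘_; _$_; _⇔_; mk⇔; Equivalence)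
open import Relation.Binary.PropositionalEquality
  using (_≡_; _≢_; _≗_; refl; sym; trans; cong; cong₂; subst; subst₂)
open import Relation.Nullary.Decidable using (dec-true; dec-false; decidable-stable)
open import Relation.Nullary using (¬_; yes; no; does; contradiction)

-- Runs of machines, and tapes in unary notation.

Halts-functional : ∀ {q w} {xs : Vec 𝒩 q} {P : List (Instruction q (2 + w))} {c m n} →
  Halts xs P c m → Halts xs P c n → m ≡ n
Halts-functional (halted _) (halted _) = refl
Halts-functional (halted p) (next r _) with () ← trans (sym p) r
Halts-functional (next r _) (halted p) with () ← trans (sym p) r
Halts-functional (next r s) (next r′ s′) with refl ← just-injective (trans (sym r) r′) =
  Halts-functional s s′

halts-with : ∀ {q w} {xs : Vec 𝒩 q} {P : List (Instruction q (2 + w))} {c n} →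
  step xs P c ≡ nothing → value (head (Config.tapes c)) ≡ n → Halts xs P c n
halts-with p refl = halted p

-- A left move from `ones n as` with a variable `n` does not compute; such a run is continued along
-- an equation between tapes.
retape : ∀ {q w} {xs : Vec 𝒩 q} {P : List (Instruction q (2 + w))} {s ts ts′ n} →
  ts ≡ ts′ → Halts xs P (config s ts) n → Halts xs P (config s ts′) n
retape refl r = r

Computes : ∀ {q} → Machine q → Vec 𝒩 q → 𝒩 → Set
Computes M xs y = ∀ i → Halts xs (Machine.program M) (initial i) (y i)

ones : ℕ → List ℕ → List ℕ
ones zero    as = as
ones (suc n) as = 1 ∷ ones n as

ones-shift : ∀ n as → ones n (1 ∷ as) ≡ 1 ∷ ones n as
ones-shift zero    as = refl
ones-shift (suc n) as = cong (1 ∷_) (ones-shift n as)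

fromCellsˡ : List ℕ → List ℕ → Tape
fromCellsˡ []       rs = tape [] 0 rs
fromCellsˡ (a ∷ ls) rs = tape ls a rs

act-left : ∀ b ls {a rs} → act (b , left) (tape ls a rs) ≡ fromCellsˡ ls (b ∷ rs)
act-left b []       = refl
act-left b (_ ∷ ls) = refl

-- The stored blanks may run out, after which moving left supplies fresh ones; hence the truncated
-- predecessor.
act-left-zeros : ∀ b n {a rs} →
  act (b , left) (tape (replicate n 0) a rs) ≡ tape (replicate (pred n) 0) 0 (b ∷ rs)
act-left-zeros b zero    = refl
act-left-zeros b (suc n) = refl

fromCells-zeros : ∀ ls n → fromCells ls (replicate n 0) ≡ tape ls 0 (replicate (pred n) 0)
fromCells-zeros ls zero    = refl
fromCells-zeros ls (suc n) = refl

value-ones : ∀ ls n rs → strokes rs ≡ 0 → value (fromCells ls (ones n rs)) ≡ n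
value-ones ls zero    []      _ = refl
value-ones ls zero    (a ∷ rs) p = p
value-ones ls (suc n) rs      p = cong suc (strokes-ones n)
  where
  strokes-ones : ∀ n → strokes (ones n rs) ≡ n
  strokes-ones zero    = p
  strokes-ones (suc n) = cong suc (strokes-ones n)

-- Auxiliary machines

-- Erasing one stroke suffices, because the output is counted from the head only up to the first
-- cell that is not a stroke.
zeroMachine : Machine 0
zeroMachine = mkMachine 0 (move 0 (1 ∷ 0 ∷ []) ((0 , stay) ∷ (0 , stay) ∷ []) 1 ∷ [])

zeroMachine-correct : Computes zeroMachine [] 0𝒩
zeroMachine-correct zero    = halted refl
zeroMachine-correct (suc i) = next refl (halted refl)

-- The output grows to the left of the input, with a blank kept between them so that no input stroke
-- is counted. The query is made with a blank query tape, that is, at 0.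
sucMachine : Machine 1
sucMachine = mkMachine 0
  ( move 0 (0 ∷ 0 ∷ []) ((0 , left) ∷ (0 , stay) ∷ []) 1
  ∷ move 0 (1 ∷ 0 ∷ []) ((1 , left) ∷ (0 , stay) ∷ []) 1
  ∷ move 1 (0 ∷ 0 ∷ []) ((0 , left) ∷ (0 , stay) ∷ []) 2
  ∷ query 2 zero 3
  ∷ move 3 (0 ∷ 1 ∷ []) ((1 , left) ∷ (1 , right) ∷ []) 3
  ∷ move 3 (0 ∷ 0 ∷ []) ((1 , stay) ∷ (0 , stay) ∷ []) 4
  ∷ [])

sucMachine-correct : ∀ x → Computes sucMachine (x ∷ []) (λ _ → suc (x 0))
sucMachine-correct x = start
  where
  xs = x ∷ []
  P = Machine.program sucMachine
  output : ∀ n m ls rs → Halts xs P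
    (config 3 (tape [] 0 (ones m (0 ∷ rs)) ∷ fromCells ls (replicate n 1) ∷ []))
    (suc (n + m))
  output zero m ls rs =
    next refl (halts-with refl (value-ones [] (suc m) (0 ∷ rs) refl))
  output (suc n) m ls rs = next refl
    (subst (λ k → Halts xs P (config 3 (tape [] 0 (ones (suc m) (0 ∷ rs)) ∷
        fromCells (1 ∷ ls) (replicate n 1) ∷ [])) (suc k))
      (+-suc n m) (output n (suc m) (1 ∷ ls) rs))
  output₀ : ∀ rs → Halts xs P
    (config 3 (tape [] 0 (0 ∷ rs) ∷ numeral (x 0) ∷ [])) (suc (x 0))
  output₀ rs = subst (Halts xs P _) (cong suc (+-identityʳ (x 0))) (output (x 0) 0 [] rs)
  start : ∀ i → Halts xs P (initial i) (suc (x 0))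
  start zero    = next refl (next refl (next refl (output₀ _)))
  start (suc i) = next refl (next refl (next refl (output₀ _)))

indicator : ℕ → 𝒩
indicator n m = if does (m ≟ n) then 1 else 0

indicatorMachine : Machine 1
indicatorMachine = mkMachine 0
  ( query 0 zero 1
  ∷ move 1 (1 ∷ 1 ∷ []) ((1 , right) ∷ (1 , right) ∷ []) 1
  ∷ move 1 (0 ∷ 0 ∷ []) ((1 , stay) ∷ (0 , stay) ∷ []) 2
  ∷ move 1 (1 ∷ 0 ∷ []) ((0 , stay) ∷ (0 , stay) ∷ []) 2
  ∷ [])

indicatorMachine-correct : ∀ x → Computes indicatorMachine (x ∷ []) (indicator (x 0))
indicatorMachine-correct x i = next refl (compare i (x 0) [] [])
  where
  compare : ∀ m n ls ls′ → Halts (x ∷ []) (Machine.program indicatorMachine)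
    (config 1 (fromCells ls (replicate m 1) ∷ fromCells ls′ (replicate n 1) ∷ []))
    (indicator n m)
  compare zero    zero    ls ls′ = next refl (halted refl)
  -- State 1 has no instruction for a blank on tape 0 against a stroke on tape 1, so the run ends
  -- scanning that blank: output 0.
  compare zero    (suc n) ls ls′ = halted refl
  compare (suc m) zero    ls ls′ = next refl (halted refl)
  compare (suc m) (suc n) ls ls′ = next refl (compare m n (1 ∷ ls) (1 ∷ ls′))

-- The machine that computes a component of a decoded pair.

data Component : Set where
  first second : Component

component : Component → ℕ × ℕ → ℕ
component first  = proj₁
component second = proj₂

-- How the head of tape 1 first moves, and then reads, to output a component.
outset heading : Component → Direction
outset first   = left
outset second  = stay
heading first  = left
heading second = right

-- The code of a nonempty list is `suc` of a pair, so its head and the code of its tail are the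
-- components of its predecessor.
onPred : (ℕ → ℕ) → 𝒩
onPred f zero    = 0
onPred f (suc n) = f n

-- The number of strokes on the input, less one, is the number of times nextPair is applied to
-- (0 , 0).  The pair (a , b) is kept on tape 1 as a strokes left and b strokes right of the
-- head, so that nextPair (suc a , b) is a single move to the left; for a = 0 the head meets a
-- blank instead, and then runs to the right end (state 3) and appends a stroke.
unpairMachine : Component → Machine 0
unpairMachine κ = mkMachine 0
  ( move 0 (1 ∷ 0 ∷ []) ((0 , right) ∷ (0 , right) ∷ []) 1
  ∷ move 1 (1 ∷ 0 ∷ []) ((1 , stay) ∷ (0 , left) ∷ []) 2
  ∷ move 1 (1 ∷ 1 ∷ []) ((1 , stay) ∷ (1 , left) ∷ []) 2
  ∷ move 2 (1 ∷ 1 ∷ []) ((0 , right) ∷ (1 , stay) ∷ []) 1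
  ∷ move 2 (1 ∷ 0 ∷ []) ((1 , stay) ∷ (0 , right) ∷ []) 3
  ∷ move 3 (1 ∷ 1 ∷ []) ((1 , stay) ∷ (1 , right) ∷ []) 3
  ∷ move 3 (1 ∷ 0 ∷ []) ((0 , right) ∷ (1 , right) ∷ []) 1
  ∷ move 1 (0 ∷ 0 ∷ []) ((0 , stay) ∷ (0 , outset κ) ∷ []) 4
  ∷ move 1 (0 ∷ 1 ∷ []) ((0 , stay) ∷ (1 , outset κ) ∷ []) 4
  ∷ move 4 (0 ∷ 1 ∷ []) ((1 , left) ∷ (1 , heading κ) ∷ []) 4
  ∷ move 4 (0 ∷ 0 ∷ []) ((0 , right) ∷ (0 , stay) ∷ []) 5
  ∷ [])

module _ (κ : Component) where
  private
    P = Machine.program (unpairMachine κ)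

  -- The blank at either end is stored explicitly, so that the moves lead from one such tape to the
  -- next by computation.
  pairTape : ℕ × ℕ → Tape
  pairTape (a , b) = fromCells (ones a (0 ∷ [])) (ones b (0 ∷ []))

  -- The strokes crossed and the one appended at the end all come to lie left of the head, which is
  -- how `(0 , b)` becomes `(suc b , 0)`. Run segments are stated as maps on the remaining run, so
  -- that they compose by application.
  unpair-rewind : ∀ {v} b a z io →
    Halts [] P (config 1 (fromCells (0 ∷ z) io ∷ pairTape (suc (b + a) , 0) ∷ [])) v →
    Halts [] P (config 3 (tape z 1 io ∷ fromCells (ones a (0 ∷ [])) (ones b (0 ∷ [])) ∷ [])) v
  unpair-rewind zero    a z io r = next refl r
  unpair-rewind {v} (suc b) a z io r = next refl (unpair-rewind b (suc a) z io
    (subst (λ k → Halts [] P (config 1 (fromCells (0 ∷ z) io ∷ pairTape (suc k , 0) ∷ [])) v)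
      (sym (+-suc b a)) r))

  unpair-step : ∀ {v} p z io →
    Halts [] P (config 1 (fromCells (0 ∷ z) io ∷ pairTape (nextPair p) ∷ [])) v →
    Halts [] P (config 1 (tape z 1 io ∷ pairTape p ∷ [])) v
  unpair-step (suc a , zero)  z io r = next refl (next refl r)
  unpair-step (suc a , suc b) z io r = next refl (next refl r)
  unpair-step {v} (zero , zero)  z io r = next refl (next refl (unpair-rewind 0 0 z io r))
  unpair-step {v} (zero , suc b) z io r = next refl (next refl (unpair-rewind (suc b) 0 z io
    (subst (λ k → Halts [] P (config 1 (fromCells (0 ∷ z) io ∷ pairTape (suc (suc k) , 0) ∷ [])) v)
      (sym (+-identityʳ b)) r)))

  -- `n` input strokes remain and `nextPair` has been applied `m` times. The number of blanks left
  -- behind is kept arbitrary, since the output phase works over any supply of them.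
  unpair-loop : ∀ {v} n m z →
    (∀ z′ → Halts [] P (config 1 (tape (replicate z′ 0) 0 [] ∷ pairTape (unpair (n + m)) ∷ [])) v) →
    Halts [] P (config 1 (fromCells (replicate z 0) (replicate n 1) ∷ pairTape (unpair m) ∷ [])) v
  unpair-loop zero    m z r = r z
  unpair-loop {v} (suc n) m z r = unpair-step (unpair m) _ _
    (unpair-loop n (suc m) (suc z)
      (subst (λ k → ∀ z′ → Halts [] P
                (config 1 (tape (replicate z′ 0) 0 [] ∷ pairTape (unpair k) ∷ [])) v)
        (sym (+-suc n m)) r))

source : Component → ℕ → List ℕ → Tape
source first  n junk = fromCellsˡ (ones n (0 ∷ [])) junk
source second n junk = fromCells junk (ones n (0 ∷ []))

unpair-output : ∀ κ n m z junk → Halts [] (Machine.program (unpairMachine κ))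
  (config 4 (tape (replicate z 0) 0 (ones m []) ∷ source κ n junk ∷ [])) (n + m)
unpair-output first  zero m z junk =
  next refl (halts-with refl (value-ones _ m [] refl))
unpair-output second zero m z junk =
  next refl (halts-with refl (value-ones _ m [] refl))
unpair-output first (suc n) m z junk = next refl
  (retape (sym (cong₂ (λ io w → io ∷ w ∷ [])
      (act-left-zeros 1 z) (act-left 1 (ones n (0 ∷ [])))))
    (subst (Halts [] _ _) (+-suc n m)
      (unpair-output first n (suc m) (pred z) (1 ∷ junk))))
unpair-output second (suc n) m z junk = next refl
  (retape (cong (_∷ _) (sym (act-left-zeros 1 z)))
    (subst (Halts [] _ _) (+-suc n m)
      (unpair-output second n (suc m) (pred z) (1 ∷ junk))))

unpair-finish : ∀ κ p z → Halts [] (Machine.program (unpairMachine κ))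
  (config 1 (tape (replicate z 0) 0 [] ∷ pairTape κ p ∷ [])) (component κ p)
unpair-finish κ p z = subst (Halts [] _ _) (+-identityʳ _) (go κ p)
  where
  go : ∀ κ p → Halts [] (Machine.program (unpairMachine κ))
    (config 1 (tape (replicate z 0) 0 [] ∷ pairTape κ p ∷ [])) (component κ p + 0)
  go first  (zero  , zero)  = next refl (unpair-output first zero 0 z _)
  go first  (zero  , suc b) = next refl (unpair-output first zero 0 z _)
  go first  (suc a , zero)  = next refl (unpair-output first (suc a) 0 z _)
  go first  (suc a , suc b) = next refl (unpair-output first (suc a) 0 z _)
  go second (a , zero)      = next refl (unpair-output second zero 0 z _)
  go second (a , suc b)     = next refl (unpair-output second (suc b) 0 z _)

unpairMachine-correct : ∀ κ →
  Computes (unpairMachine κ) [] (onPred (component κ ∘ unpair))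
unpairMachine-correct κ zero    = halted refl
-- The first instruction drops one stroke and moves tape 1 to the right, which stores the blank that
-- makes it `pairTape κ (0 , 0)`.
unpairMachine-correct κ (suc i) = next refl (unpair-loop κ i 0 1
  (subst (λ k → ∀ z′ → Halts [] (Machine.program (unpairMachine κ))
            (config 1 (tape (replicate z′ 0) 0 [] ∷ pairTape κ (unpair k) ∷ []))
            (component κ (unpair i)))
    (sym (+-identityʳ i)) (unpair-finish κ (unpair i))))

-- The machine that compares a list with a point

agrees : 𝒩 → ℕ → List ℕ → ℕ
agrees x k []      = 1
agrees x k (a ∷ l) = if does (x k ≟ a) then agrees x (suc k) l else 0

gate : ℕ → ℕ → ℕ
gate zero    n = 0
gate (suc _) n = n

pattern oracle-x = zero
pattern oracle-h = suc zero
pattern oracle-t = suc (suc zero)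
pattern oracle-z = suc (suc (suc zero))
pattern oracle-s = suc (suc (suc (suc zero)))
pattern oracle-ι = suc (suc (suc (suc (suc zero))))

-- Tape 2 holds the current position k and tape 3 the current list element.  The query tape is
-- cleared by querying the zero oracle.
matchProgram : List (Instruction 6 4)
matchProgram =
    -- 0–3: copy the input n, add a stroke, and test whether ι (h (suc n)) ≠ 0
    move 0 (1 ∷ 0 ∷ 0 ∷ 0 ∷ []) ((1 , right) ∷ (1 , left) ∷ (0 , stay) ∷ (0 , stay) ∷ []) 0
  ∷ move 0 (0 ∷ 0 ∷ 0 ∷ 0 ∷ []) ((0 , stay) ∷ (1 , stay) ∷ (0 , stay) ∷ (0 , stay) ∷ []) 1
  ∷ query 1 oracle-h 2
  ∷ query 2 oracle-ι 3
  ∷ move 3 (0 ∷ 1 ∷ 0 ∷ 0 ∷ []) ((0 , left) ∷ (1 , stay) ∷ (0 , stay) ∷ (0 , stay) ∷ []) 4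
    -- 4–6: with a cleared query tape, copy n again and obtain the code s n
  ∷ query 4 oracle-z 5
  ∷ move 5 (1 ∷ 0 ∷ 0 ∷ 0 ∷ []) ((1 , left) ∷ (1 , left) ∷ (0 , stay) ∷ (0 , stay) ∷ []) 5
  ∷ move 5 (0 ∷ 0 ∷ 0 ∷ 0 ∷ []) ((0 , left) ∷ (0 , right) ∷ (0 , stay) ∷ (0 , stay) ∷ []) 6
  ∷ query 6 oracle-s 7
    -- 7: write the code on fresh cells left of everything written on tape 0 so far
  ∷ move 7 (0 ∷ 1 ∷ 0 ∷ 0 ∷ []) ((1 , left) ∷ (1 , right) ∷ (0 , stay) ∷ (0 , stay) ∷ []) 7
  ∷ move 7 (0 ∷ 0 ∷ 0 ∷ 0 ∷ []) ((0 , right) ∷ (0 , stay) ∷ (0 , stay) ∷ (0 , stay) ∷ []) 8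
    -- 8–13: output 1 if the code is 0; otherwise copy it and obtain the first element
  ∷ query 8 oracle-z 9
  ∷ move 9 (0 ∷ 0 ∷ 0 ∷ 0 ∷ []) ((0 , left) ∷ (0 , stay) ∷ (0 , stay) ∷ (0 , stay) ∷ []) 10
  ∷ move 10 (0 ∷ 0 ∷ 0 ∷ 0 ∷ []) ((1 , stay) ∷ (0 , stay) ∷ (0 , stay) ∷ (0 , stay) ∷ []) 11
  ∷ move 9 (1 ∷ 0 ∷ 0 ∷ 0 ∷ []) ((1 , right) ∷ (1 , left) ∷ (0 , stay) ∷ (0 , stay) ∷ []) 12
  ∷ move 12 (1 ∷ 0 ∷ 0 ∷ 0 ∷ []) ((1 , right) ∷ (1 , left) ∷ (0 , stay) ∷ (0 , stay) ∷ []) 12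
  ∷ move 12 (0 ∷ 0 ∷ 0 ∷ 0 ∷ []) ((0 , stay) ∷ (0 , right) ∷ (0 , stay) ∷ (0 , stay) ∷ []) 13
  ∷ query 13 oracle-h 14
    -- 14: move that element to tape 3
  ∷ move 14 (0 ∷ 1 ∷ 0 ∷ 0 ∷ []) ((0 , stay) ∷ (1 , right) ∷ (0 , stay) ∷ (1 , right) ∷ []) 14
  ∷ move 14 (0 ∷ 0 ∷ 0 ∷ 0 ∷ []) ((0 , stay) ∷ (0 , stay) ∷ (0 , right) ∷ (0 , stay) ∷ []) 15
    -- 15–18: copy k from tape 2 and increase it there, then obtain x k
  ∷ query 15 oracle-z 16
  ∷ move 16 (0 ∷ 0 ∷ 1 ∷ 0 ∷ []) ((0 , stay) ∷ (1 , left) ∷ (1 , right) ∷ (0 , stay) ∷ []) 16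
  ∷ move 16 (0 ∷ 0 ∷ 0 ∷ 0 ∷ []) ((0 , stay) ∷ (0 , stay) ∷ (1 , left) ∷ (0 , stay) ∷ []) 17
  ∷ move 17 (0 ∷ 0 ∷ 1 ∷ 0 ∷ []) ((0 , stay) ∷ (0 , stay) ∷ (1 , left) ∷ (0 , stay) ∷ []) 17
  ∷ move 17 (0 ∷ 0 ∷ 0 ∷ 0 ∷ []) ((0 , stay) ∷ (0 , right) ∷ (0 , stay) ∷ (0 , left) ∷ []) 18
  ∷ query 18 oracle-x 19
    -- 19: compare the two; halt with output 0 if they differ
  ∷ move 19 (0 ∷ 1 ∷ 0 ∷ 1 ∷ []) ((0 , stay) ∷ (1 , right) ∷ (0 , stay) ∷ (0 , left) ∷ []) 19
  ∷ move 19 (0 ∷ 0 ∷ 0 ∷ 0 ∷ []) ((0 , left) ∷ (0 , stay) ∷ (0 , stay) ∷ (0 , stay) ∷ []) 20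
    -- 20–22: replace the code by its tail and repeat
  ∷ query 20 oracle-z 21
  ∷ move 21 (1 ∷ 0 ∷ 0 ∷ 0 ∷ []) ((1 , left) ∷ (1 , left) ∷ (0 , stay) ∷ (0 , stay) ∷ []) 21
  ∷ move 21 (0 ∷ 0 ∷ 0 ∷ 0 ∷ []) ((0 , left) ∷ (0 , right) ∷ (0 , stay) ∷ (0 , stay) ∷ []) 22
  ∷ query 22 oracle-t 7
  ∷ []

matchMachine : Machine 6
matchMachine = mkMachine 2 matchProgram

-- Correctness of the comparing machine.

module _ (x h t z s ι : 𝒩)
  (h-head : ∀ n → h (suc n) ≡ proj₁ (unpair n))
  (t-tail : ∀ n → t (suc n) ≡ proj₂ (unpair n))
  (z-zero : ∀ n → z n ≡ 0)
  where
  private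
    _⊢_⇓_ : ℕ → Vec Tape 4 → ℕ → Set
    q ⊢ ts ⇓ v = Halts (x ∷ h ∷ t ∷ z ∷ s ∷ ι ∷ []) matchProgram (config q ts) v

    -- The head rests on the blank before the strokes, where leftward copying ends; one move to the
    -- right makes the tape readable as `k`.
    counter : ℕ → Tape
    counter k = tape [] 0 (ones k [])

    -- Erased cells remain stored as blanks, so tape 3 is blank only up to their number.
    blank : ℕ → Tape
    blank n = tape [] 0 (replicate n 0)

    asked : ∀ {q io ts v n m} → n ≡ m →
      q ⊢ io ∷ numeral m ∷ ts ⇓ v → q ⊢ io ∷ numeral n ∷ ts ⇓ v
    asked refl r = r

    on-third : ∀ {q io qt k k′ a v} → k ≡ k′ →
      q ⊢ io ∷ qt ∷ k ∷ a ∷ [] ⇓ v → q ⊢ io ∷ qt ∷ k′ ∷ a ∷ [] ⇓ v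
    on-third refl r = r

    on-fourth : ∀ {q io qt k a a′ v} → a ≡ a′ →
      q ⊢ io ∷ qt ∷ k ∷ a ∷ [] ⇓ v → q ⊢ io ∷ qt ∷ k ∷ a′ ∷ [] ⇓ v
    on-fourth refl r = r

    copy-input : ∀ {v} n m →
      0 ⊢ tape (ones (n + m) []) 0 [] ∷ counter (n + m) ∷ counter 0 ∷ blank 0 ∷ [] ⇓ v →
      0 ⊢ fromCells (ones m []) (replicate n 1) ∷ counter m ∷ counter 0 ∷ blank 0 ∷ [] ⇓ v
    copy-input zero    m r = r
    copy-input {v} (suc n) m r = next refl (copy-input n (suc m)
      (subst (λ k → 0 ⊢ tape (ones k []) 0 [] ∷ counter k ∷ counter 0 ∷ blank 0 ∷ [] ⇓ v)
        (sym (+-suc n m)) r))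

    -- Leftward copying to the query tape occurs twice, once for the input and once for a code; the
    -- two differ only in the state and in whether a blank is stored beyond the strokes.
    data Phase : Set where
      opening looping : Phase

    back : Phase → ℕ
    back opening = 5
    back looping = 21

    edge : Phase → List ℕ
    edge opening = []
    edge looping = 0 ∷ []

    copy-back : ∀ {v} φ n m rs k e →
      back φ ⊢ tape [] 0 (ones n rs) ∷ counter (n + m) ∷ counter k ∷ blank e ∷ [] ⇓ v →
      back φ ⊢ fromCellsˡ (ones n (edge φ)) rs ∷ counter m ∷ counter k ∷ blank e ∷ [] ⇓ v
    copy-back opening zero m rs k e r = r
    copy-back looping zero m rs k e r = r
    copy-back {v} φ (suc n) m rs k e r = forth φ (retape
        (cong (_∷ _) (sym (act-left 1 (ones n (edge φ)))))
        (copy-back φ n (suc m) (1 ∷ rs) k e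
          (subst₂ (λ l j → back φ ⊢ tape [] 0 l ∷ counter j ∷ counter k ∷ blank e ∷ [] ⇓ v)
            (sym (ones-shift n rs)) (sym (+-suc n m)) r)))
      where
      forth : ∀ φ {ls} →
        back φ ⊢ act (1 , left) (tape ls 1 rs) ∷ counter (suc m) ∷ counter k ∷ blank e ∷ [] ⇓ v →
        back φ ⊢ tape ls 1 rs ∷ counter m ∷ counter k ∷ blank e ∷ [] ⇓ v
      forth opening r = next refl r
      forth looping r = next refl r

    -- The continuation has to serve every `ls`: what stays behind on the query tape disappears at
    -- the next query, which replaces the whole tape.
    transfer : ∀ {v} c m ls rs k e →
      (∀ ls → 7 ⊢ tape [] 0 (ones (c + m) rs) ∷ tape ls 0 [] ∷ counter k ∷ blank e ∷ [] ⇓ v) →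
      7 ⊢ tape [] 0 (ones m rs) ∷ fromCells ls (replicate c 1) ∷ counter k ∷ blank e ∷ [] ⇓ v
    transfer zero    m ls rs k e r = r ls
    transfer {v} (suc c) m ls rs k e r = next refl (transfer c (suc m) (1 ∷ ls) rs k e
      (λ ls → subst (λ j → 7 ⊢ tape [] 0 (ones j rs) ∷ tape ls 0 [] ∷ counter k ∷ blank e ∷ [] ⇓ v)
        (sym (+-suc c m)) (r ls)))

    copy-code : ∀ {v} n m rs k e →
      12 ⊢ tape (ones (n + m) (0 ∷ [])) 0 rs ∷ counter (n + m) ∷ counter k ∷ blank e ∷ [] ⇓ v →
      12 ⊢ fromCells (ones m (0 ∷ [])) (ones n (0 ∷ rs)) ∷ counter m ∷ counter k ∷ blank e ∷ [] ⇓ v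
    copy-code zero    m rs k e r = r
    copy-code {v} (suc n) m rs k e r = next refl (copy-code n (suc m) rs k e
      (subst (λ j → 12 ⊢ tape (ones j (0 ∷ [])) 0 rs ∷ counter j ∷ counter k ∷ blank e ∷ [] ⇓ v)
        (sym (+-suc n m)) r))

    store : ∀ {v} a m ls io rs k e →
      (∀ ls e → 14 ⊢ tape io 0 rs ∷ tape ls 0 [] ∷ counter k ∷
                     tape (ones (a + m) []) 0 (replicate e 0) ∷ [] ⇓ v) →
      14 ⊢ tape io 0 rs ∷ fromCells ls (replicate a 1) ∷ counter k ∷
           tape (ones m []) 0 (replicate e 0) ∷ [] ⇓ v
    store zero    m ls io rs k e r = r ls e
    store {v} (suc a) m ls io rs k e r = next refl (on-fourth
      (sym (fromCells-zeros (1 ∷ ones m []) e))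
      (store a (suc m) (1 ∷ ls) io rs k (pred e)
        (λ ls e → subst (λ j → 14 ⊢ tape io 0 rs ∷ tape ls 0 [] ∷ counter k ∷
              tape (ones j []) 0 (replicate e 0) ∷ [] ⇓ v)
          (sym (+-suc a m)) (r ls e))))

    copy-counter : ∀ {v} n m io rs ls rs′ →
      16 ⊢ tape io 0 rs ∷ counter (n + m) ∷ tape (ones (n + m) (0 ∷ [])) 0 [] ∷
           tape ls 0 rs′ ∷ [] ⇓ v →
      16 ⊢ tape io 0 rs ∷ counter m ∷ fromCells (ones m (0 ∷ [])) (ones n []) ∷ tape ls 0 rs′ ∷ [] ⇓ v
    copy-counter zero    m io rs ls rs′ r = r
    copy-counter {v} (suc n) m io rs ls rs′ r = next refl (copy-counter n (suc m) io rs ls rs′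
      (subst (λ j → 16 ⊢ tape io 0 rs ∷ counter j ∷ tape (ones j (0 ∷ [])) 0 [] ∷ tape ls 0 rs′ ∷
            [] ⇓ v)
        (sym (+-suc n m)) r))

    rewind-counter : ∀ {v} n m io rs k ls rs′ →
      17 ⊢ tape io 0 rs ∷ counter k ∷ counter (n + m) ∷ tape ls 0 rs′ ∷ [] ⇓ v →
      17 ⊢ tape io 0 rs ∷ counter k ∷ fromCellsˡ (ones n (0 ∷ [])) (ones m []) ∷
           tape ls 0 rs′ ∷ [] ⇓ v
    rewind-counter zero    m io rs k ls rs′ r = r
    rewind-counter {v} (suc n) m io rs k ls rs′ r = next refl (on-third
      (sym (act-left 1 (ones n (0 ∷ []))))
      (rewind-counter n (suc m) io rs k ls rs′
        (subst (λ j → 17 ⊢ tape io 0 rs ∷ counter k ∷ counter j ∷ tape ls 0 rs′ ∷ [] ⇓ v)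
          (sym (+-suc n m)) r)))

    compare : ∀ {v} m n ls io rs k e →
      (m ≡ n → ∀ ls e → 19 ⊢ tape io 0 rs ∷ tape ls 0 [] ∷ counter k ∷ blank e ∷ [] ⇓ v) →
      (m ≢ n → 0 ≡ v) →
      19 ⊢ tape io 0 rs ∷ fromCells ls (replicate m 1) ∷ counter k ∷
           fromCellsˡ (ones n []) (replicate e 0) ∷ [] ⇓ v
    compare zero    zero    ls io rs k e y n = y refl ls e
    -- With only one of the two tapes exhausted, state 19 has no instruction, and tape 0 scans a
    -- blank.
    compare zero    (suc _) ls io rs k e y n = halts-with refl (n λ ())
    compare (suc _) zero    ls io rs k e y n = halts-with refl (n λ ())
    compare (suc a) (suc b) ls io rs k e y n = next refl (on-fourth (sym (act-left 0 (ones b [])))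
      (compare a b (1 ∷ ls) io rs k (suc e)
        (λ eq → y (cong suc eq)) (λ ne → n (ne ∘ suc-injective))))

    agrees-here : ∀ {k a} l → x k ≡ a → agrees x k (a ∷ l) ≡ agrees x (suc k) l
    agrees-here {k} {a} l eq =
      cong (if_then agrees x (suc k) l else 0) (dec-true (x k ≟ a) eq)

    agrees-not-here : ∀ {k a} l → x k ≢ a → 0 ≡ agrees x k (a ∷ l)
    agrees-not-here {k} {a} l neq =
      sym (cong (if_then agrees x (suc k) l else 0) (dec-false (x k ≟ a) neq))

    -- Induction on the list, with state 7 as the entry of the loop. Older codes stay in `rs`,
    -- screened off by a blank; each new code is written to their left.
    check : ∀ l k e rs ls →
      7 ⊢ tape [] 0 (ones (codeList l) (0 ∷ rs)) ∷ tape ls 0 [] ∷ counter k ∷ blank e ∷ []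
        ⇓ agrees x k l
    -- The stroke is written one cell further left, in front of a blank, so that strokes in `rs` do
    -- not count towards the output.
    check [] k e rs ls =
      next refl $ next refl $ asked (z-zero _) $ next refl $ next refl $ halted refl
    check (a ∷ l) k e rs ls =
      next refl $ next refl $ asked (z-zero _) $ next refl $
      -- The `1` is the stroke already copied by the instruction that recognised a nonzero code in
      -- state 9.
      copy-code c 1 rs k e $
      subst (λ n → 12 ⊢ tape (ones n (0 ∷ [])) 0 rs ∷ counter n ∷ counter k ∷ blank e ∷
            [] ⇓ agrees x k (a ∷ l))
        (+-comm 1 c) $
      next refl $ next refl $ asked head-value $ store a 0 [] _ rs k e λ ls₁ e₁ →
      subst (λ n → 14 ⊢ tape code 0 rs ∷ tape ls₁ 0 [] ∷ counter k ∷
            tape (ones n []) 0 (replicate e₁ 0) ∷ [] ⇓ agrees x k (a ∷ l))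
        (sym (+-identityʳ a)) $
      next refl $ next refl $ asked (z-zero _) $
      copy-counter k 0 _ rs _ _ $
      subst (λ n → 16 ⊢ tape code 0 rs ∷ counter n ∷ tape (ones n (0 ∷ [])) 0 [] ∷
            tape (ones a []) 0 (replicate e₁ 0) ∷ [] ⇓ agrees x k (a ∷ l))
        (sym (+-identityʳ k)) $
      next refl $ on-third (sym (act-left 1 (ones k _))) $
      -- The `1` is the stroke just appended to tape 2, which is rewound as `suc k`.
      rewind-counter k 1 _ rs k _ _ $
      subst (λ n → 17 ⊢ tape code 0 rs ∷ counter k ∷ counter n ∷
            tape (ones a []) 0 (replicate e₁ 0) ∷ [] ⇓ agrees x k (a ∷ l))
        (+-comm 1 k) $
      next refl $ on-fourth (sym (act-left 0 (ones a _))) $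
      next refl $ asked (cong x (value-ones _ k [] refl)) $
      compare (x k) a [] _ rs (suc k) (suc e₁) same (agrees-not-here l)
      where
      c = pair a (codeList l)
      code = ones (suc c) (0 ∷ [])
      head-value : h (value (fromCells (0 ∷ []) (ones (suc c) []))) ≡ a
      head-value = trans (cong h (value-ones (0 ∷ []) (suc c) [] refl))
        (trans (h-head c) (cong proj₁ (unpair-pair a (codeList l))))
      tail-value : t (value (fromCells (0 ∷ []) (ones (suc c) []))) ≡ codeList l
      tail-value = trans (cong t (value-ones (0 ∷ []) (suc c) [] refl))
        (trans (t-tail c) (cong proj₂ (unpair-pair a (codeList l))))
      same : x k ≡ a → ∀ ls e →
        19 ⊢ tape code 0 rs ∷ tape ls 0 [] ∷ counter (suc k) ∷ blank e ∷ [] ⇓ agrees x k (a ∷ l)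
      same eq ls e = subst (Halts _ _ _) (sym (agrees-here l eq)) $
        next refl $ next refl $ asked (z-zero _) $
        copy-back looping (suc c) 0 (0 ∷ rs) (suc k) e $
        subst (λ n → 21 ⊢ tape [] 0 (ones (suc c) (0 ∷ rs)) ∷ counter n ∷ counter (suc k) ∷
              blank e ∷ [] ⇓ agrees x (suc k) l)
          (sym (+-identityʳ (suc c))) $
        next refl $ next refl $ asked tail-value $
        transfer (codeList l) 0 [] _ (suc k) e λ ls₁ →
        subst (λ n → 7 ⊢ tape [] 0 (ones n (0 ∷ ones (suc c) (0 ∷ rs))) ∷ tape ls₁ 0 [] ∷
              counter (suc k) ∷ blank e ∷ [] ⇓ agrees x (suc k) l)
          (sym (+-identityʳ (codeList l))) $
        check l (suc k) e _ ls₁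

  matchProgram-correct : ∀ l n → s n ≡ codeList l →
    Halts (x ∷ h ∷ t ∷ z ∷ s ∷ ι ∷ []) matchProgram (initial n)
      (gate (ι (proj₁ (unpair n))) (agrees x 0 l))
  matchProgram-correct l n s-code =
    copy-input n 0 $
    subst (λ k → 0 ⊢ tape (ones k []) 0 [] ∷ counter k ∷ counter 0 ∷ blank 0 ∷ [] ⇓ result)
      (sym (+-identityʳ n)) $
    next refl $ next refl $ asked head-value $
    next refl $ asked (cong ι (value-numeral (proj₁ (unpair n)))) $
    select (ι (proj₁ (unpair n)))
    where
    result = gate (ι (proj₁ (unpair n))) (agrees x 0 l)
    value-numeral : ∀ n → value (numeral n) ≡ n
    value-numeral zero = refl
    value-numeral (suc zero) = refl
    value-numeral (suc (suc n)) = cong suc (value-numeral (suc n))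
    head-value : h (value (tape [] 1 (ones n []))) ≡ proj₁ (unpair n)
    head-value = trans (cong h (value-ones [] (suc n) [] refl)) (h-head n)
    code-value : s (value (fromCells (0 ∷ []) (ones n []))) ≡ codeList l
    code-value = trans (cong s (value-ones (0 ∷ []) n [] refl)) s-code
    select : ∀ m → 3 ⊢ tape (ones n []) 0 [] ∷ numeral m ∷ counter 0 ∷ blank 0 ∷ []
                     ⇓ gate m (agrees x 0 l)
    -- With a blank query tape, state 3 has no instruction; the head of tape 0 is on the blank after
    -- the input.
    select zero    = halted refl
    select (suc m) =
      next refl $ retape (cong (_∷ _) (sym (act-left 0 (ones n [])))) $
      next refl $ asked (z-zero _) $
      copy-back opening n 0 (0 ∷ []) 0 0 $
      subst (λ k → 5 ⊢ tape [] 0 (ones n (0 ∷ [])) ∷ counter k ∷ counter 0 ∷ blank 0 ∷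
            [] ⇓ agrees x 0 l)
        (sym (+-identityʳ n)) $
      next refl $ next refl $ asked code-value $
      transfer (codeList l) 0 [] _ 0 0 λ ls →
      subst (λ k → 7 ⊢ tape [] 0 (ones k (0 ∷ ones n (0 ∷ []))) ∷ tape ls 0 [] ∷ counter 0 ∷
            blank 0 ∷ [] ⇓ agrees x 0 l)
        (sym (+-identityʳ (codeList l))) $
      check l 0 0 _ ls

-- One sequence testing a whole row of basic open sets.

-- The machine for `σ` is only known to be correct on inputs `pair i j`; this makes every input one
-- of them.
pair-unpair : ∀ n → uncurry pair (unpair n) ≡ n
pair-unpair zero    = refl
pair-unpair (suc n) = trans (pair-nextPair (unpair n)) (cong suc (pair-unpair n))
  where
  pair-nextPair : ∀ p → uncurry pair (nextPair p) ≡ suc (uncurry pair p)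
  pair-nextPair (zero  , b) rewrite +-identityʳ b = refl
  pair-nextPair (suc a , b) rewrite +-suc a b = refl

agrees-cong : ∀ {x x′} → x ≗ x′ → ∀ k l → agrees x k l ≡ agrees x′ k l
agrees-cong p k []      = refl
agrees-cong p k (a ∷ l) rewrite p k | agrees-cong p (suc k) l = refl

agrees-complete : ∀ x k l → (∀ i → x (k + toℕ i) ≡ List.lookup l i) → agrees x k l ≡ 1
agrees-complete x k []      p = refl
agrees-complete x k (a ∷ l) p =
  trans (cong (if_then agrees x (suc k) l else 0)
          (dec-true (x k ≟ a) (trans (cong x (sym (+-identityʳ k))) (p zero))))
    (agrees-complete x (suc k) l λ i → trans (cong x (sym (+-suc k (toℕ i)))) (p (suc i)))

agrees-sound : ∀ x k l → agrees x k l ≢ 0 → ∀ i → x (k + toℕ i) ≡ List.lookup l i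
agrees-sound x k (a ∷ l) ne i with x k ≟ a
... | no neq = contradiction (cong (if_then agrees x (suc k) l else 0) (dec-false (x k ≟ a) neq)) ne
agrees-sound x k (a ∷ l) ne zero    | yes eq = trans (cong x (+-identityʳ k)) eq
agrees-sound x k (a ∷ l) ne (suc i) | yes eq = trans (cong x (+-suc k (toℕ i)))
  (agrees-sound x (suc k) l
    (λ p → ne (trans (cong (if_then agrees x (suc k) l else 0) (dec-true (x k ≟ a) eq)) p)) i)

-- The oracle for `σ` lists all rows together, so row `i` is singled out by gating with an
-- indicator, and no pairing has to be computed.
hits : (ℕ → ℕ → List ℕ) → ℕ → 𝒩 → 𝒩
hits σ i x n = gate (indicator i (proj₁ (unpair n))) (agrees x 0 (uncurry σ (unpair n)))

Meets : (ℕ → ℕ → List ℕ) → ℕ → 𝒩 → Set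
Meets σ i x = ∃ λ j → ⟦ σ i j ⟧ x

hits-complete : ∀ σ i x → hits σ i x ≗ 0𝒩 → ¬ Meets σ i x
hits-complete σ i x none (j , m) with none (pair i j)
... | p rewrite unpair-pair i j | dec-true (i ≟ i) refl | agrees-complete x 0 (σ i j) m with () ← p

hits-sound : ∀ σ i x → ¬ Meets σ i x → hits σ i x ≗ 0𝒩
hits-sound σ i x avoids n with unpair n
... | i′ , j with i′ ≟ i
...   | no neq rewrite dec-false (i′ ≟ i) neq = refl
...   | yes refl rewrite dec-true (i ≟ i) refl with agrees x 0 (σ i j) ≟ 0
...     | yes p  = p
...     | no  ne = contradiction (j , agrees-sound x 0 (σ i j) ne) avoids

-- Total computable functions

infix 4 _≈_
_≈_ : ∀ {τ} → Value τ → Value τ → Set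
_≈_ {num} = _≡_
_≈_ {seq} = _≗_

≈-trans : ∀ τ {u v w : Value τ} → _≈_ {τ} u v → _≈_ {τ} v w → _≈_ {τ} u w
≈-trans num p q = trans p q
≈-trans seq p q i = trans (p i) (q i)

Fun : ℕ → ℕ → Codomain → Set
Fun p q τ = Vec ℕ p → Vec 𝒩 q → Value τ

graph : ∀ {p q τ} → Fun p q τ → PFun p q τ
graph {τ = τ} f ns xs v = _≈_ {τ} v (f ns xs)

_≋_ : ∀ {q} → Vec 𝒩 q → Vec 𝒩 q → Set
xs ≋ ys = ∀ j → lookup xs j ≗ lookup ys j

-- In a composition the inner sequences are determined only up to `≗`, so recursiveness of the graph
-- has to travel with respect for `≗`.
record Computable {p q} τ (f : Fun p q τ) : Set₁ where
  constructor computable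
  field
    extensional : ∀ ns {xs ys} → xs ≋ ys → _≈_ {τ} (f ns xs) (f ns ys)
    recursive   : PartialRecursive (graph {τ = τ} f)
open Computable

≡-tabulate : ∀ {A : Set} {n} {as : Vec A n} {f} → (∀ i → lookup as i ≡ f i) → as ≡ tabulate f
≡-tabulate {as = as} p = trans (sym (tabulate∘lookup as)) (tabulate-cong p)

lookup-tabulate : ∀ {q} (f : Fin q → 𝒩) j → lookup (tabulate f) j ≗ f j
lookup-tabulate f j n = cong (λ y → y n) (lookup∘tabulate f j)

compose-computable : ∀ {p q m n τ}
  {f : Fun p q τ} {g : Fin p → Fun m n num} {h : Fin q → Fun m n seq} →
  Computable τ f → (∀ i → Computable num (g i)) → (∀ j → Computable seq (h j)) →
  Computable τ (λ ns xs → f (tabulate λ i → g i ns xs) (tabulate λ j → h j ns xs))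
compose-computable {m = m} {n} {τ} {f} {g} {h} F G H = computable ext
  (graph-rec equiv (comp-rec (recursive F) (λ i → recursive (G i)) (λ j → recursive (H j))))
  where
  gs : Vec ℕ m → Vec 𝒩 n → Vec ℕ _
  gs ns xs = tabulate λ i → g i ns xs
  hs : Vec ℕ m → Vec 𝒩 n → Vec 𝒩 _
  hs ns xs = tabulate λ j → h j ns xs
  composite : PFun m n τ
  composite = compose (graph f) (λ i → graph (g i)) (λ j → graph (h j))
  ext : ∀ ns {xs ys} → xs ≋ ys → _≈_ {τ} (f (gs ns xs) (hs ns xs)) (f (gs ns ys) (hs ns ys))
  ext ns {xs} {ys} p =
    subst (λ ms → _≈_ {τ} (f (gs ns xs) (hs ns xs)) (f ms (hs ns ys)))
      (tabulate-cong λ i → extensional (G i) ns p)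
      (extensional F _ λ j n → trans (lookup-tabulate _ j n)
        (trans (extensional (H j) ns p n) (sym (lookup-tabulate (λ j → h j ns ys) j n))))
  equiv : ∀ ns xs v → composite ns xs v ⇔ _≈_ {τ} v (f (gs ns xs) (hs ns xs))
  equiv ns xs v = mk⇔ to from
    where
    to : composite ns xs v → _≈_ {τ} v (f (gs ns xs) (hs ns xs))
    to (ms , ys , ms≡ , ys≗ , fv) with refl ← ≡-tabulate {as = ms} ms≡ =
      ≈-trans τ fv (extensional F _ λ j n →
        trans (ys≗ j n) (sym (lookup-tabulate (λ j → h j ns xs) j n)))
    from : _≈_ {τ} v (f (gs ns xs) (hs ns xs)) → composite ns xs v
    from p = gs ns xs , hs ns xs , lookup∘tabulate _ , lookup-tabulate _ , p

projℕ-computable : ∀ {p q} i → Computable {p} {q} num (λ ns xs → lookup ns i)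
projℕ-computable i = computable (λ _ _ → refl) (projℕ-rec i)

proj𝒩-computable : ∀ {p q} j → Computable {p} {q} seq (λ ns xs → lookup xs j)
proj𝒩-computable j = computable (λ _ p → p j) (proj𝒩-rec j)

const-computable : ∀ {p q} k → Computable {suc p} {q} num (λ _ _ → k)
const-computable zero =
  compose-computable {q = 0} {f = λ _ _ → 0} {h = λ ()} (computable (λ _ _ → refl) zero-rec)
    (λ _ → projℕ-computable zero) (λ ())
const-computable (suc k) =
  compose-computable {q = 0} {f = λ ns _ → suc (head ns)} {h = λ ()}
    (computable (λ _ _ → refl) (graph-rec (λ { (n ∷ []) _ _ → mk⇔ (λ p → p) (λ p → p) }) suc-rec))
    (λ _ → const-computable k) (λ ())

-- Abstract, so that Agda never evaluates the astronomical index of a machine.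
abstract
  machine-computable : ∀ {p q r} (M : Machine r)
    {h : Fin r → Fun (suc p) q seq} {y : Fun (suc p) q seq} →
    (∀ j → Computable seq (h j)) →
    (∀ ns xs os → (∀ j → lookup os j ≗ h j ns xs) → Computes M os (y ns xs)) →
    Computable seq y
  machine-computable {p} {q} {r} M {h} {y} H correct with machine-surjective r M
  ... | e , refl = computable ext
    (graph-rec (λ ns xs v → mk⇔ (to ns xs) (from ns xs))
      (comp-rec (Ψ-rec r) (λ _ → recursive (const-computable e)) (λ j → recursive (H j))))
    where
    run : PFun (suc p) q seq
    run = compose (Ψ r) (λ _ → graph (λ _ _ → e)) (λ j → graph (h j))
    ext : ∀ ns {xs ys} → xs ≋ ys → y ns xs ≗ y ns ys
    -- The same oracle vector is admissible for `xs` and for `ys`, so determinism of the machine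
    -- equates the two outputs.
    ext ns {xs} {ys} p i = Halts-functional
      (correct ns xs (tabulate λ j → h j ns xs) (lookup-tabulate _) i)
      (correct ns ys _ (λ j n → trans (lookup-tabulate _ j n) (extensional (H j) ns p n)) i)
    to : ∀ ns xs {v} → run ns xs v → v ≗ y ns xs
    to ns xs (_ ∷ [] , os , e≡ , os≗ , halts) i with refl ← e≡ zero =
      Halts-functional (halts i) (correct ns xs os os≗ i)
    from : ∀ ns xs {v} → v ≗ y ns xs → run ns xs v
    from ns xs p =
      e ∷ [] , tabulate (λ j → h j ns xs) , (λ { zero → refl }) , lookup-tabulate _ ,
      λ i → subst (Φ _ e i) (sym (p i)) (correct ns xs _ (lookup-tabulate _) i)

-- Passing numbers to oracles, and the oracles of the comparing machine.

-- Applied to `0𝒩`, this gives the constant sequence `k`, so that primitive recursion into `𝒩` makes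
-- a number available to machines and to `χ`.
raise : ℕ → 𝒩 → 𝒩
raise zero    y = y
raise (suc k) y = λ _ → suc (raise k y 0)

raise-computable : Computable {1} {1} seq (λ ns xs → raise (head ns) (head xs))
raise-computable = computable (λ { (k ∷ []) {x ∷ []} {y ∷ []} p → ext k (p zero) })
  (graph-rec (λ { (k ∷ []) (x ∷ []) v → mk⇔ (to k) (from k) })
    (prim𝒩-rec (proj𝒩-rec {0} {1} zero)
      -- Primitive recursion appends the previous value after the parameter, hence the index
      -- `suc zero`.
      (recursive (machine-computable sucMachine {y = λ ns xs _ → suc (lookup xs (suc zero) 0)}
        (λ _ → proj𝒩-computable (suc zero))
        (λ { ns xs (o ∷ []) hs i →
          subst (Halts _ _ _) (cong suc (hs zero 0)) (sucMachine-correct o i) })))))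
  where
  ext : ∀ k {x y} → x ≗ y → raise k x ≗ raise k y
  ext zero    p = p
  ext (suc k) p _ = cong suc (ext k p 0)
  G : PFun 0 1 seq
  G = proj𝒩 zero
  S′ : PFun 1 2 seq
  S′ = graph {τ = seq} λ ns xs _ → suc (lookup xs (suc zero) 0)
  to : ∀ k {x v} → primrec𝒩 G S′ (k ∷ []) (x ∷ []) v → v ≗ raise k x
  to zero    p = p
  to (suc k) (u , p , q) i = trans (q i) (cong suc (to k p 0))
  from : ∀ k {x v} → v ≗ raise k x → primrec𝒩 G S′ (k ∷ []) (x ∷ []) v
  from zero    p = p
  from (suc k) {x} p = raise k x , from k (λ _ → refl) , p

zero-computable : ∀ {p q} → Computable {suc p} {q} seq (λ _ _ → 0𝒩)
zero-computable = machine-computable zeroMachine {h = λ ()} (λ ())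
  λ { _ _ [] _ → zeroMachine-correct }

constant-computable : ∀ {p q} {f : Fun (suc p) q num} → Computable num f →
  Computable seq (λ ns xs → raise (f ns xs) 0𝒩)
constant-computable {f = f} F = compose-computable {g = λ _ → f} {h = λ _ _ _ → 0𝒩}
  raise-computable (λ _ → F) (λ _ → zero-computable)

raise-0 : ∀ k → raise k 0𝒩 0 ≡ k
raise-0 zero    = refl
raise-0 (suc k) = cong suc (raise-0 k)

head-computable : ∀ {p q} → Computable {p} {suc q} seq (λ _ xs → head xs)
head-computable = computable (λ { _ {_ ∷ _} {_ ∷ _} p → p zero })
  (graph-rec (λ { _ (_ ∷ _) _ → mk⇔ (λ p → p) (λ p → p) }) (proj𝒩-rec zero))

onPred-component-computable : ∀ {p q} κ →
  Computable {suc p} {q} seq (λ _ _ → onPred (component κ ∘ unpair))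
onPred-component-computable κ = machine-computable (unpairMachine κ) {h = λ ()} (λ ())
  λ { _ _ [] _ → unpairMachine-correct κ }

indicator-computable : ∀ {p q} {f : Fun (suc p) q num} → Computable num f →
  Computable seq (λ ns xs → indicator (f ns xs))
indicator-computable {f = f} F = machine-computable indicatorMachine
  (λ _ → constant-computable F)
  λ { ns xs (o ∷ []) hs n → subst
        (λ k → Halts (o ∷ []) (Machine.program indicatorMachine) (initial n) (indicator k n))
        (trans (hs zero 0) (raise-0 (f ns xs))) (indicatorMachine-correct o n) }

module _ (σ : ℕ → ℕ → List ℕ) where

  matchOracle : Fin 6 → Fun 1 1 seq
  matchOracle oracle-x ns xs = head xs
  matchOracle oracle-h ns xs = onPred (component first ∘ unpair)
  matchOracle oracle-t ns xs = onPred (component second ∘ unpair)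
  matchOracle oracle-z ns xs = 0𝒩
  matchOracle oracle-s ns xs = λ n → codeList (uncurry σ (unpair n))
  matchOracle oracle-ι ns xs = indicator (lookup ns zero)

  codes-computable : RecursiveDoubleSequence σ →
    Computable {1} {1} seq (λ _ _ n → codeList (uncurry σ (unpair n)))
  codes-computable (e , σ-rec) = machine-computable (machine 0 e) {h = λ ()} (λ ())
    λ { _ _ [] _ n → subst (λ m → Φ [] e m (codeList (uncurry σ (unpair n)))) (pair-unpair n)
          (uncurry σ-rec (unpair n)) }

  matchOracle-computable : RecursiveDoubleSequence σ → ∀ j → Computable seq (matchOracle j)
  matchOracle-computable _ oracle-x = head-computable
  matchOracle-computable _ oracle-h = onPred-component-computable first
  matchOracle-computable _ oracle-t = onPred-component-computable second
  matchOracle-computable _ oracle-z = zero-computable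
  matchOracle-computable r oracle-s = codes-computable r
  matchOracle-computable _ oracle-ι = indicator-computable (projℕ-computable zero)

  matchMachine-correct : ∀ ns xs os → (∀ j → lookup os j ≗ matchOracle j ns xs) →
    Computes matchMachine os (hits σ (head ns) (head xs))
  matchMachine-correct (i ∷ []) (x ∷ []) (x′ ∷ h ∷ t ∷ z ∷ s ∷ ι ∷ []) hs n =
    subst (Halts (x′ ∷ h ∷ t ∷ z ∷ s ∷ ι ∷ []) matchProgram (initial n))
      (cong₂ gate (hs oracle-ι (proj₁ (unpair n)))
        (agrees-cong (hs oracle-x) 0 (uncurry σ (unpair n))))
      (matchProgram-correct x′ h t z s ι
        (λ m → hs oracle-h (suc m)) (λ m → hs oracle-t (suc m)) (hs oracle-z)
        (uncurry σ (unpair n)) n (hs oracle-s n))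

  hits-computable : RecursiveDoubleSequence σ →
    Computable {1} {1} seq (λ ns xs → hits σ (head ns) (head xs))
  hits-computable σ-rec =
    machine-computable matchMachine (matchOracle-computable σ-rec) matchMachine-correct

-- Decisions by `χ` and the condition for the search to stop.

least : ∀ (f : ℕ → ℕ) k → f k ≡ 0 → ∃ λ m → f m ≡ 0 × (∀ j → j < m → f j ≢ 0)
least f k p with f 0 ≟ 0
... | yes q = 0 , q , λ _ ()
least f zero    p | no q = contradiction p q
least f (suc k) p | no q with least (f ∘ suc) k p
... | m , r , below = suc m , r , λ { zero _ → q ; (suc j) (s≤s j<m) → below j j<m }

module _ (em : ExcludedMiddle 0ℓ) where

  -- Excluded middle makes the graph `χ` total, so that it can be treated as a function.
  vanishes : 𝒩 → ℕ
  vanishes x = if does (em {x ≗ 0𝒩}) then 1 else 0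

  vanishes-graph : ∀ x → χ [] (x ∷ []) (vanishes x)
  vanishes-graph x with em {x ≗ 0𝒩}
  ... | yes p = inj₁ (p , refl)
  ... | no ¬p = inj₂ (¬p , refl)

  χ-functional : ∀ {x y u v} → x ≗ y → χ [] (x ∷ []) u → χ [] (y ∷ []) v → u ≡ v
  χ-functional p (inj₁ (_ , refl)) (inj₁ (_ , refl)) = refl
  χ-functional p (inj₂ (_ , refl)) (inj₂ (_ , refl)) = refl
  χ-functional p (inj₁ (q , _)) (inj₂ (r , _)) = contradiction (λ n → trans (sym (p n)) (q n)) r
  χ-functional p (inj₂ (q , _)) (inj₁ (r , _)) = contradiction (λ n → trans (p n) (r n)) q

  vanishes-computable : ∀ {p q} {f : Fun p q seq} → Computable seq f →
    Computable num (λ ns xs → vanishes (f ns xs))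
  vanishes-computable {f = f} F = compose-computable
    {f = λ _ xs → vanishes (head xs)} {g = λ ()} {h = λ _ → f}
    (computable
      (λ { _ {x ∷ []} {y ∷ []} p → χ-functional (p zero) (vanishes-graph x) (vanishes-graph y) })
      (graph-rec (λ { [] (x ∷ []) v → mk⇔
          (λ p → χ-functional (λ _ → refl) p (vanishes-graph x))
          (λ { refl → vanishes-graph x }) }) χ-rec))
    (λ ()) (λ _ → F)

  avoids : (ℕ → ℕ → List ℕ) → ℕ → 𝒩 → ℕ
  avoids σ i x = vanishes (hits σ i x)

  avoids-spec : ∀ σ i x → (¬ Meets σ i x × avoids σ i x ≡ 1) ⊎ (Meets σ i x × avoids σ i x ≡ 0)
  avoids-spec σ i x with vanishes-graph (hits σ i x)
  ... | inj₁ (p , q) = inj₁ (hits-complete σ i x p , q)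
  ... | inj₂ (p , q) with em {Meets σ i x}
  ...   | yes m = inj₂ (m , q)
  ...   | no ¬m = contradiction (hits-sound σ i x ¬m) p

  -- raise b (raise a 0𝒩) is the constant sequence b + a.
  neither : (σ τ : ℕ → ℕ → List ℕ) → ℕ → 𝒩 → ℕ
  neither σ τ i x = vanishes (raise (avoids τ i x) (raise (avoids σ i x) 0𝒩))

  avoids-computable : ∀ σ → RecursiveDoubleSequence σ →
    Computable {1} {1} num (λ ns xs → avoids σ (head ns) (head xs))
  avoids-computable σ σ-rec = vanishes-computable (hits-computable σ σ-rec)

  neither-computable : ∀ σ τ → RecursiveDoubleSequence σ → RecursiveDoubleSequence τ →
    Computable {1} {1} num (λ ns xs → neither σ τ (head ns) (head xs))
  neither-computable σ τ σ-rec τ-rec = vanishes-computable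
    (compose-computable
      {g = λ _ ns xs → avoids τ (head ns) (head xs)}
      {h = λ _ ns xs → raise (avoids σ (head ns) (head xs)) 0𝒩}
      raise-computable (λ _ → avoids-computable τ τ-rec)
      (λ _ → constant-computable (avoids-computable σ σ-rec)))

  vanishes-0𝒩 : ∀ {x} → x ≗ 0𝒩 → vanishes x ≡ 1
  vanishes-0𝒩 {x} p = χ-functional (λ _ → refl) (vanishes-graph x) (inj₁ (p , refl))

  vanishes-≢ : ∀ {x} → x 0 ≢ 0 → vanishes x ≡ 0
  vanishes-≢ {x} ne = χ-functional (λ _ → refl) (vanishes-graph x) (inj₂ ((λ p → ne (p 0)) , refl))

  -- If both rows were met, both values of `avoids` would be 0, their sum the zero sequence, and
  -- `neither` equal to 1.
  decided : ∀ σ τ i x → neither σ τ i x ≡ 0 → ¬ (Meets σ i x × Meets τ i x)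
  decided σ τ i x p (m , m′) with avoids-spec σ i x | avoids-spec τ i x
  ... | inj₁ (¬m , _) | _ = ¬m m
  ... | inj₂ _ | inj₁ (¬m , _) = ¬m m′
  ... | inj₂ (_ , q) | inj₂ (_ , r) with () ← trans (sym p)
    (vanishes-0𝒩 (λ n → cong₂ (λ a b → raise b (raise a 0𝒩) n) q r))

  neither-0 : ∀ σ τ i x → ¬ Meets σ i x ⊎ ¬ Meets τ i x → neither σ τ i x ≡ 0
  neither-0 σ τ i x ¬mm with avoids-spec σ i x | avoids-spec τ i x | ¬mm
  -- `avoids τ` is the outer `raise`, so its value 1 alone makes the sequence start with a
  -- successor.
  ... | _ | inj₁ (_ , r) | _ = vanishes-≢ λ eq → contradiction
    (trans (sym eq) (cong (λ b → raise b (raise (avoids σ i x) 0𝒩) 0) r)) λ ()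
  ... | inj₁ (_ , q) | inj₂ (_ , r) | _ = vanishes-≢ λ eq → contradiction
    (trans (sym eq) (cong₂ (λ a b → raise b (raise a 0𝒩) 0) q r)) λ ()
  ... | inj₂ (m , _) | inj₂ _ | inj₁ ¬m = contradiction m ¬m
  ... | inj₂ _ | inj₂ (m , _) | inj₂ ¬m = contradiction m ¬m

  ∃-avoided : ∀ σ x → ¬ (∀ i → Meets σ i x) → ∃ λ i → ¬ Meets σ i x
  ∃-avoided σ x ¬all with em {∃ λ i → ¬ Meets σ i x}
  ... | yes e = e
  ... | no ¬e = contradiction (λ i → decidable-stable em λ ¬m → ¬e (i , ¬m)) ¬all

-- The characteristic function as a search followed by one test.

lemma2p21 : ExcludedMiddle 0ℓ → (A : Pred 𝒩 0ℓ) → Δ⁰₂ A → Recursive A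
lemma2p21 em A ((τ , τ-rec , τ-spec) , (σ , σ-rec , σ-spec)) =
  graph-rec (λ { [] (x ∷ []) v → mk⇔ sound complete })
    -- `τ` describes the complement, so `avoids` for `τ` at the index found is already the required
    -- value: 1 exactly when `x` is in `A`.
    (comp-rec (recursive (avoids-computable em τ τ-rec))
      (λ _ → μ-rec (recursive (neither-computable em σ τ σ-rec τ-rec)))
      (λ _ → proj𝒩-rec zero))
  where
  open Equivalence

  Answer : PFun 1 1 num
  Answer = graph {τ = num} λ ns xs → avoids em τ (head ns) (head xs)

  Searched : PFun 1 1 num
  Searched = graph {τ = num} λ ns xs → neither em σ τ (head ns) (head xs)

  answer : ∀ i x → neither em σ τ i x ≡ 0 → characteristic A [] (x ∷ []) (avoids em τ i x)
  answer i x p with avoids-spec em τ i x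
  ... | inj₁ (¬m , q) = inj₁ (decidable-stable em (λ ¬a → ¬m (to (τ-spec x) ¬a i)) , q)
  -- Membership in `A` would meet row `i` of `σ` as well, which the search has excluded.
  ... | inj₂ (m , q)  = inj₂ ((λ a → decided em σ τ i x p (to (σ-spec x) a i , m)) , q)

  characteristic-functional : ∀ {x u v} →
    characteristic A [] (x ∷ []) u → characteristic A [] (x ∷ []) v → u ≡ v
  characteristic-functional (inj₁ (_ , refl)) (inj₁ (_ , refl)) = refl
  characteristic-functional (inj₂ (_ , refl)) (inj₂ (_ , refl)) = refl
  characteristic-functional (inj₁ (a , _)) (inj₂ (¬a , _)) = contradiction a ¬a
  characteristic-functional (inj₂ (¬a , _)) (inj₁ (a , _)) = contradiction a ¬a

  witness : ∀ x → ∃ λ i → neither em σ τ i x ≡ 0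
  witness x with em {A x}
  -- A point of `A` must miss some row of `τ`, since meeting them all would put it in the
  -- complement; outside `A` the same holds for `σ`.
  ... | yes a = let i , ¬m = ∃-avoided em τ x (λ all → from (τ-spec x) all a)
                in i , neither-0 em σ τ i x (inj₂ ¬m)
  ... | no ¬a = let i , ¬m = ∃-avoided em σ x (λ all → ¬a (from (σ-spec x) all))
                in i , neither-0 em σ τ i x (inj₁ ¬m)

  sound : ∀ {x v} → compose Answer (λ _ → minimize Searched) (λ _ → proj𝒩 zero) [] (x ∷ []) v →
    characteristic A [] (x ∷ []) v
  sound {x} (i ∷ [] , y ∷ [] , gs , hs , refl) =
    subst (characteristic A [] _)
      -- The sequence `y` supplied by the composition is only pointwise equal to `x`.
      (sym (extensional (avoids-computable em τ τ-rec) (i ∷ []) {y ∷ []} {x ∷ []}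
        λ { zero → hs zero }))
      (answer i x (sym (proj₁ (gs zero))))

  complete : ∀ {x v} → characteristic A [] (x ∷ []) v →
    compose Answer (λ _ → minimize Searched) (λ _ → proj𝒩 zero) [] (x ∷ []) v
  complete {x} c with witness x
  ... | k , p with least (λ i → neither em σ τ i x) k p
  ... | i , q , below = i ∷ [] , x ∷ [] ,
    (λ { zero → sym q , λ j j<i → _ , refl , below j j<i }) , (λ { zero _ → refl }) ,
    characteristic-functional c (answer i x q)
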